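{- The transition system space $\mathrm{BPA}^*_{01}$ is less expressive than the transition system space $\mathrm{PA}^*_{01}$: every $\mathrm{BPA}^*_{01}$ expression is bisimilar to some $\mathrm{PA}^*_{01}$ expression, and there exists a $\mathrm{PA}^*_{01}$ expression that is not bisimilar to any $\mathrm{BPA}^*_{01}$ expression.
   Context: Fix a non-empty set $A$ of actions. $\mathrm{PA}^*_{01}$ expressions are generated by $p ::= \mathbf{0} \mid \mathbf{1} \mid a \mid p\cdot p \mid p+p \mid p^* \mid p\parallel p$ with $a\in A$; $\mathrm{BPA}^*_{01}$ expressions are those without $\parallel$. The transition relation $p\xrightarrow{a}p'$ ($a\in A$) and termination predicate $p\downarrow$ are the least relations such that: $\mathbf{1}\downarrow$; $a\xrightarrow{a}\mathbf{1}$; if $p\xrightarrow{a}p'$ then $p+q\xrightarrow{a}p'$ and $q+p\xrightarrow{a}p'$; if $p\downarrow$ then $(p+q)\downarrow$ and $(q+p)\downarrow$; if $p\xrightarrow{a}p'$ then $p\cdot q\xrightarrow{a}p'\cdot q$; if $p\downarrow$ and $q\xrightarrow{a}q'$ then $p\cdot q\xrightarrow{a}q'$; if $p\downarrow$ and $q\downarrow$ then $(p\cdot q)\downarrow$; if $p\xrightarrow{a}p'$ then $p^*\xrightarrow{a}p'\cdot p^*$; $p^*\downarrow$; if $p\xrightarrow{a}p'$ then $p\parallel q\xrightarrow{a}p'\parallel q$; if $q\xrightarrow{a}q'$ then $p\parallel q\xrightarrow{a}p\parallel q'$; if $p\downarrow$ and $q\downarrow$ then $(p\parallel q)\downarrow$.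 The transition system space $\mathrm{PA}^*_{01}$ (resp. $\mathrm{BPA}^*_{01}$) has the $\mathrm{PA}^*_{01}$ (resp. $\mathrm{BPA}^*_{01}$) expressions as states with these relations. A bisimulation between transition system spaces $(S_1,\to_1,\downarrow_1)$ and $(S_2,\to_2,\downarrow_2)$ is a relation $R\subseteq S_1\times S_2$ such that whenever $s_1 R s_2$: each $s_1\xrightarrow{a}_1 s_1'$ is matched by some $s_2\xrightarrow{a}_2 s_2'$ with $s_1' R s_2'$; each $s_2\xrightarrow{a}_2 s_2'$ is matched by some $s_1\xrightarrow{a}_1 s_1'$ with $s_1' R s_2'$; and $s_1\downarrow_1$ iff $s_2\downarrow_2$. States are bisimilar if related by some bisimulation. $T_1$ is less expressive than $T_2$ if every state of $T_1$ is bisimilar to a state of $T_2$ and some state of $T_2$ is bisimilar to no state of $T_1$. -}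

module Defs where

open import Level using (Level; _⊔_; suc)
open import Data.Product using (Σ; ∃; _×_; _,_)
open import Relation.Nullary using (¬_)
open import Function.Bundles using (_⇔_)

record TSS (A : Set) : Set₁ where
  field
    State : Set
    _⟶[_]_ : State → A → State → Set
    _↓ : State → Set

open TSS

IsBisimulation : {A : Set} (T₁ T₂ : TSS A) → (State T₁ → State T₂ → Set) → Set
IsBisimulation {A} T₁ T₂ R =
  ∀ s₁ s₂ → R s₁ s₂ →
    ((a : A) (s₁' : State T₁) → _⟶[_]_ T₁ s₁ a s₁' →
        Σ (State T₂) λ s₂' → _⟶[_]_ T₂ s₂ a s₂' × R s₁' s₂')
  × ((a : A) (s₂' : State T₂) → _⟶[_]_ T₂ s₂ a s₂' →
        Σ (State T₁) λ s₁' → _⟶[_]_ T₁ s₁ a s₁' × R s₁' s₂')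
  × (_↓ T₁ s₁ ⇔ _↓ T₂ s₂)

Bisimilar : {A : Set} (T₁ T₂ : TSS A) → State T₁ → State T₂ → Set₁
Bisimilar T₁ T₂ s₁ s₂ =
  Σ (State T₁ → State T₂ → Set) λ R → IsBisimulation T₁ T₂ R × R s₁ s₂

LessExpressive : {A : Set} (T₁ T₂ : TSS A) → Set₁
LessExpressive T₁ T₂ =
  ((s₁ : State T₁) → Σ (State T₂) λ s₂ → Bisimilar T₁ T₂ s₁ s₂)
  × Σ (State T₂) λ s₂ → ¬ Σ (State T₁) λ s₁ → Bisimilar T₁ T₂ s₁ s₂

module _ (A : Set) where

  data PA : Set where
    𝟘 𝟙 : PA
    act : A → PA
    _·_ _⊕_ _∥_ : PA → PA → PA
    _⋆ : PA → PA

  data PA↓ : PA → Set where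
    one↓ : PA↓ 𝟙
    sumˡ↓ : ∀ {p q} → PA↓ p → PA↓ (p ⊕ q)
    sumʳ↓ : ∀ {p q} → PA↓ q → PA↓ (p ⊕ q)
    seq↓ : ∀ {p q} → PA↓ p → PA↓ q → PA↓ (p · q)
    star↓ : ∀ {p} → PA↓ (p ⋆)
    par↓ : ∀ {p q} → PA↓ p → PA↓ q → PA↓ (p ∥ q)

  data PA⟶ : PA → A → PA → Set where
    act⟶ : ∀ {a} → PA⟶ (act a) a 𝟙
    sumˡ⟶ : ∀ {p q a p'} → PA⟶ p a p' → PA⟶ (p ⊕ q) a p'
    sumʳ⟶ : ∀ {p q a q'} → PA⟶ q a q' → PA⟶ (p ⊕ q) a q'
    seqˡ⟶ : ∀ {p q a p'} → PA⟶ p a p' → PA⟶ (p · q) a (p' · q)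
    seqʳ⟶ : ∀ {p q a q'} → PA↓ p → PA⟶ q a q' → PA⟶ (p · q) a q'
    star⟶ : ∀ {p a p'} → PA⟶ p a p' → PA⟶ (p ⋆) a (p' · (p ⋆))
    parˡ⟶ : ∀ {p q a p'} → PA⟶ p a p' → PA⟶ (p ∥ q) a (p' ∥ q)
    parʳ⟶ : ∀ {p q a q'} → PA⟶ q a q' → PA⟶ (p ∥ q) a (p ∥ q')

  PA*01 : TSS A
  PA*01 = record { State = PA ; _⟶[_]_ = PA⟶ ; _↓ = PA↓ }

module _ (A : Set) where

  data BPA : Set where
    𝟘 𝟙 : BPA
    act : A → BPA
    _·_ _⊕_ : BPA → BPA → BPA
    _⋆ : BPA → BPA

  data BPA↓ : BPA → Set where
    one↓ : BPA↓ 𝟙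
    sumˡ↓ : ∀ {p q} → BPA↓ p → BPA↓ (p ⊕ q)
    sumʳ↓ : ∀ {p q} → BPA↓ q → BPA↓ (p ⊕ q)
    seq↓ : ∀ {p q} → BPA↓ p → BPA↓ q → BPA↓ (p · q)
    star↓ : ∀ {p} → BPA↓ (p ⋆)

  data BPA⟶ : BPA → A → BPA → Set where
    act⟶ : ∀ {a} → BPA⟶ (act a) a 𝟙
    sumˡ⟶ : ∀ {p q a p'} → BPA⟶ p a p' → BPA⟶ (p ⊕ q) a p'
    sumʳ⟶ : ∀ {p q a q'} → BPA⟶ q a q' → BPA⟶ (p ⊕ q) a q'
    seqˡ⟶ : ∀ {p q a p'} → BPA⟶ p a p' → BPA⟶ (p · q) a (p' · q)
    seqʳ⟶ : ∀ {p q a q'} → BPA↓ p → BPA⟶ q a q' → BPA⟶ (p · q) a q'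
    star⟶ : ∀ {p a p'} → BPA⟶ p a p' → BPA⟶ (p ⋆) a (p' · (p ⋆))

  BPA*01 : TSS A
  BPA*01 = record { State = BPA ; _⟶[_]_ = BPA⟶ ; _↓ = BPA↓ }

{-# OPTIONS --safe #-}

-- The separating expression runs a cycle (a a)* of length two in parallel with
-- a single a.  As long as the single a is pending, the process alternates
-- between two states P₀ and P₁; performing it leads from Pₘ to Qₘ, where Q₀ and
-- Q₁ again alternate and only Q₀ terminates.  Every state can reach termination,
-- but no Qₙ can reach any Pₘ.
--
-- In a BPA expression a cycle lives in the body p of some p*.  Suppose p → p′
-- and p′ · p* · k behaves like Pⱼ.  Any r · p* · k occurring in the process can
-- terminate, so r can terminate and restart p, reaching p′ · p* · k; hence
-- r · p* · k is never a Q.  The step from Pⱼ to Qⱼ can therefore not be made by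
-- p′, so p′ terminates, and then p′ · p* · k has a step to itself, whereas Pⱼ
-- has no step to a state bisimilar to it.  So no star contributes a step into a
-- P state, and by induction no other expression does unless its continuation
-- does, which the empty continuation does not.

module Submission where

open import Defs
open import Data.Empty using (⊥; ⊥-elim)
open import Data.List.Base using (List; []; _∷_)
open import Data.Parity.Base using (Parity; 0ℙ; 1ℙ; _⁻¹)
open import Data.Product using (∃-syntax; _×_; _,_; proj₁; proj₂)
open import Data.Sum.Base using (_⊎_; inj₁; inj₂)
open import Function.Bundles using (mk⇔; Equivalence)
open import Relation.Binary.PropositionalEquality using (_≡_; refl)
open import Relation.Nullary using (¬_)

module _ {A : Set} where

  embed : BPA A → PA A
  embed 𝟘 = 𝟘
  embed 𝟙 = 𝟙
  embed (act a) = act a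
  embed (p · q) = embed p · embed q
  embed (p ⊕ q) = embed p ⊕ embed q
  embed (p ⋆) = embed p ⋆

  embed-↓ : ∀ {p} → BPA↓ A p → PA↓ A (embed p)
  embed-↓ one↓ = one↓
  embed-↓ (sumˡ↓ d) = sumˡ↓ (embed-↓ d)
  embed-↓ (sumʳ↓ d) = sumʳ↓ (embed-↓ d)
  embed-↓ (seq↓ d e) = seq↓ (embed-↓ d) (embed-↓ e)
  embed-↓ star↓ = star↓

  embed-↓⁻¹ : ∀ p → PA↓ A (embed p) → BPA↓ A p
  embed-↓⁻¹ 𝟙 one↓ = one↓
  embed-↓⁻¹ (p · q) (seq↓ d e) = seq↓ (embed-↓⁻¹ p d) (embed-↓⁻¹ q e)
  embed-↓⁻¹ (p ⊕ q) (sumˡ↓ d) = sumˡ↓ (embed-↓⁻¹ p d)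
  embed-↓⁻¹ (p ⊕ q) (sumʳ↓ d) = sumʳ↓ (embed-↓⁻¹ q d)
  embed-↓⁻¹ (p ⋆) star↓ = star↓

  embed-⟶ : ∀ {p a p′} → BPA⟶ A p a p′ → PA⟶ A (embed p) a (embed p′)
  embed-⟶ act⟶ = act⟶
  embed-⟶ (sumˡ⟶ t) = sumˡ⟶ (embed-⟶ t)
  embed-⟶ (sumʳ⟶ t) = sumʳ⟶ (embed-⟶ t)
  embed-⟶ (seqˡ⟶ t) = seqˡ⟶ (embed-⟶ t)
  embed-⟶ (seqʳ⟶ d t) = seqʳ⟶ (embed-↓ d) (embed-⟶ t)
  embed-⟶ (star⟶ t) = star⟶ (embed-⟶ t)

  embed-⟶⁻¹ : ∀ p {a x} → PA⟶ A (embed p) a x → ∃[ p′ ] BPA⟶ A p a p′ × embed p′ ≡ x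
  embed-⟶⁻¹ (act a) act⟶ = 𝟙 , act⟶ , refl
  embed-⟶⁻¹ (p · q) (seqˡ⟶ t) with embed-⟶⁻¹ p t
  ... | p′ , t′ , refl = p′ · q , seqˡ⟶ t′ , refl
  embed-⟶⁻¹ (p · q) (seqʳ⟶ d t) with embed-⟶⁻¹ q t
  ... | q′ , t′ , refl = q′ , seqʳ⟶ (embed-↓⁻¹ p d) t′ , refl
  embed-⟶⁻¹ (p ⊕ q) (sumˡ⟶ t) with embed-⟶⁻¹ p t
  ... | p′ , t′ , refl = p′ , sumˡ⟶ t′ , refl
  embed-⟶⁻¹ (p ⊕ q) (sumʳ⟶ t) with embed-⟶⁻¹ q t
  ... | q′ , t′ , refl = q′ , sumʳ⟶ t′ , refl
  embed-⟶⁻¹ (p ⋆) (star⟶ t) with embed-⟶⁻¹ p t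
  ... | p′ , t′ , refl = p′ · (p ⋆) , star⟶ t′ , refl

  embed-bisimilar : ∀ p → Bisimilar (BPA*01 A) (PA*01 A) p (embed p)
  embed-bisimilar p = (λ q x → embed q ≡ x) , bisim , refl
    where
    bisim : IsBisimulation (BPA*01 A) (PA*01 A) (λ q x → embed q ≡ x)
    bisim q _ refl =
        (λ _ q′ t → embed q′ , embed-⟶ t , refl)
      , (λ _ _ t → embed-⟶⁻¹ q t)
      , mk⇔ embed-↓ (embed-↓⁻¹ q)

  -- Continuations are kept as a stack, so that plug (p · q) ks and
  -- plug p (q ∷ ks) are definitionally equal and no associativity law is needed.
  plug : BPA A → List (BPA A) → BPA A
  plug p [] = p
  plug p (k ∷ ks) = plug (p · k) ks

  -- Moves of the continuation alone, available once the plugged expression has terminated. The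
  -- empty stack has none, and the final contradiction rests on that.
  Stack⟶ : List (BPA A) → A → BPA A → Set
  Stack⟶ [] _ _ = ⊥
  Stack⟶ (k ∷ ks) a s = BPA⟶ A (plug k ks) a s

  plug-↓ : ∀ {p} ks → BPA↓ A (plug p ks) → BPA↓ A p
  plug-↓ [] d = d
  plug-↓ (k ∷ ks) d with plug-↓ ks d
  ... | seq↓ e _ = e

  plug-⟶ : ∀ {p a p′} ks → BPA⟶ A p a p′ → BPA⟶ A (plug p ks) a (plug p′ ks)
  plug-⟶ [] t = t
  plug-⟶ (k ∷ ks) t = plug-⟶ ks (seqˡ⟶ t)

  mutual

    plug-⟶ʳ : ∀ {p a s} ks → BPA↓ A p → Stack⟶ ks a s → BPA⟶ A (plug p ks) a s
    plug-⟶ʳ (k ∷ ks) d t with plug-⟶⁻¹ ks t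
    ... | inj₁ (_ , t′ , refl) = plug-⟶ ks (seqʳ⟶ d t′)
    ... | inj₂ (e , t′) = plug-⟶ʳ ks (seq↓ d e) t′

    plug-⟶⁻¹ : ∀ {p a s} ks → BPA⟶ A (plug p ks) a s →
               (∃[ p′ ] BPA⟶ A p a p′ × s ≡ plug p′ ks) ⊎ (BPA↓ A p × Stack⟶ ks a s)
    plug-⟶⁻¹ [] t = inj₁ (_ , t , refl)
    plug-⟶⁻¹ (k ∷ ks) t with plug-⟶⁻¹ ks t
    ... | inj₁ (_ , seqˡ⟶ t′ , refl) = inj₁ (_ , t′ , refl)
    ... | inj₁ (_ , seqʳ⟶ d t′ , refl) = inj₂ (d , plug-⟶ ks t′)
    ... | inj₂ (seq↓ d e , t′) = inj₂ (d , plug-⟶ʳ ks e t′)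

  data Normed (p : BPA A) : Set where
    now : BPA↓ A p → Normed p
    later : ∀ {a p′} → BPA⟶ A p a p′ → Normed p′ → Normed p

  module _ (a : A) where

    -- The factors `𝟙` are what performed actions leave behind; with them, every successor of
    -- `cycle m` is syntactically `cycle (m ⁻¹)`.
    cycle : Parity → PA A
    cycle 0ℙ = 𝟙 · ((act a · act a) ⋆)
    cycle 1ℙ = (𝟙 · act a) · ((act a · act a) ⋆)

    P Q : Parity → PA A
    P m = cycle m ∥ act a
    Q m = cycle m ∥ 𝟙

    cycle-⟶ : ∀ m → PA⟶ A (cycle m) a (cycle (m ⁻¹))
    cycle-⟶ 0ℙ = seqʳ⟶ one↓ (star⟶ (seqˡ⟶ act⟶))
    cycle-⟶ 1ℙ = seqˡ⟶ (seqʳ⟶ one↓ act⟶)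

    cycle-⟶⁻¹ : ∀ m {b x} → PA⟶ A (cycle m) b x → x ≡ cycle (m ⁻¹)
    cycle-⟶⁻¹ 0ℙ (seqʳ⟶ one↓ (star⟶ (seqˡ⟶ act⟶))) = refl
    cycle-⟶⁻¹ 1ℙ (seqˡ⟶ (seqʳ⟶ one↓ act⟶)) = refl
    cycle-⟶⁻¹ 1ℙ (seqʳ⟶ (seq↓ _ ()) _)

    P-⟶⁻¹ : ∀ m {b x} → PA⟶ A (P m) b x → x ≡ P (m ⁻¹) ⊎ x ≡ Q m
    P-⟶⁻¹ m (parˡ⟶ t) with cycle-⟶⁻¹ m t
    ... | refl = inj₁ refl
    P-⟶⁻¹ m (parʳ⟶ act⟶) = inj₂ refl

    Q-⟶⁻¹ : ∀ m {b x} → PA⟶ A (Q m) b x → x ≡ Q (m ⁻¹)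
    Q-⟶⁻¹ m (parˡ⟶ t) with cycle-⟶⁻¹ m t
    ... | refl = refl

    ¬P↓ : ∀ m → ¬ PA↓ A (P m)
    ¬P↓ m (par↓ _ ())

    Q₀↓ : PA↓ A (Q 0ℙ)
    Q₀↓ = par↓ (seq↓ one↓ star↓) one↓

    ¬Q₁↓ : ¬ PA↓ A (Q 1ℙ)
    ¬Q₁↓ (par↓ (seq↓ (seq↓ _ ()) _) _)

    module _ {_~_ : BPA A → PA A → Set}
             (bisim : IsBisimulation (BPA*01 A) (PA*01 A) _~_) where

      forth : ∀ {s s′ x b} → s ~ x → BPA⟶ A s b s′ → ∃[ x′ ] PA⟶ A x b x′ × s′ ~ x′
      forth r t = proj₁ (bisim _ _ r) _ _ t

      back : ∀ {s x x′ b} → s ~ x → PA⟶ A x b x′ → ∃[ s′ ] BPA⟶ A s b s′ × s′ ~ x′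
      back r t = proj₁ (proj₂ (bisim _ _ r)) _ _ t

      ↓-forth : ∀ {s x} → s ~ x → BPA↓ A s → PA↓ A x
      ↓-forth r = Equivalence.to (proj₂ (proj₂ (bisim _ _ r)))

      ↓-back : ∀ {s x} → s ~ x → PA↓ A x → BPA↓ A s
      ↓-back r = Equivalence.from (proj₂ (proj₂ (bisim _ _ r)))

      -- `Q 0ℙ` terminates and no P state does; a step of the cycle reduces `Q 1ℙ` to this case.
      P≁Q : ∀ {s} m n → s ~ P m → ¬ s ~ Q n
      P≁Q m 0ℙ rP rQ = ¬P↓ m (↓-forth rP (↓-back rQ Q₀↓))
      P≁Q m 1ℙ rP rQ with back rP (parˡ⟶ (cycle-⟶ m))
      ... | s′ , t , rP′ with forth rQ t
      ... | x , t′ , rQ′ with Q-⟶⁻¹ 1ℙ t′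
      ... | refl = P≁Q (m ⁻¹) 0ℙ rP′ rQ′

      -- Performing the single `a` takes `P 0ℙ` to the terminating `Q 0ℙ`; `P 1ℙ` can only answer
      -- with `P 0ℙ` or `Q 1ℙ`, and neither terminates.
      P₀≁P₁ : ∀ {s} → s ~ P 0ℙ → ¬ s ~ P 1ℙ
      P₀≁P₁ r₀ r₁ with back r₀ (parʳ⟶ act⟶)
      ... | s′ , t , rQ₀ with forth r₁ t
      ... | x , t′ , r′ with P-⟶⁻¹ 1ℙ t′
      ... | inj₁ refl = P≁Q 0ℙ 0ℙ r′ rQ₀
      ... | inj₂ refl = ¬Q₁↓ (↓-forth r′ (↓-back rQ₀ Q₀↓))

      P≁P⁻¹ : ∀ {s} m → s ~ P m → ¬ s ~ P (m ⁻¹)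
      P≁P⁻¹ 0ℙ r r′ = P₀≁P₁ r r′
      P≁P⁻¹ 1ℙ r r′ = P₀≁P₁ r′ r

      IsP IsQ : BPA A → Set
      IsP s = ∃[ m ] s ~ P m
      IsQ s = ∃[ m ] s ~ Q m

      IsP⇒¬IsQ : ∀ {s} → IsP s → ¬ IsQ s
      IsP⇒¬IsQ (m , r) (n , r′) = P≁Q m n r r′

      IsQ-⟶ : ∀ {s s′ b} → IsQ s → BPA⟶ A s b s′ → IsQ s′
      IsQ-⟶ (m , r) t with forth r t
      ... | x , t′ , r′ with Q-⟶⁻¹ m t′
      ... | refl = m ⁻¹ , r′

      Q-normed : ∀ {s} m → s ~ Q m → Normed s
      Q-normed 0ℙ r = now (↓-back r Q₀↓)
      Q-normed 1ℙ r with back r (parˡ⟶ (cycle-⟶ 1ℙ))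
      ... | _ , t , r′ = later t (Q-normed 0ℙ r′)

      P-irreflexive : ∀ {s c} → IsP s → ¬ BPA⟶ A s c s
      P-irreflexive (m , r) t with forth r t
      ... | x , t′ , r′ with P-⟶⁻¹ m t′
      ... | inj₁ refl = P≁P⁻¹ m r r′
      ... | inj₂ refl = P≁Q m m r r′

      module _ {p b p′} ks (p⟶p′ : BPA⟶ A p b p′) (isP : IsP (plug p′ (p ⋆ ∷ ks))) where

        restart : ∀ {r} → BPA↓ A r → BPA⟶ A (plug r (p ⋆ ∷ ks)) b (plug p′ (p ⋆ ∷ ks))
        restart d = plug-⟶ ks (seqʳ⟶ d (star⟶ p⟶p′))

        -- Induction along a terminating run. Where the run ends or passes to the stack, the current
        -- body terminates, so `restart` would take a Q state to a P state.
        normed-body⇒¬IsQ : ∀ r → Normed (plug r (p ⋆ ∷ ks)) → ¬ IsQ (plug r (p ⋆ ∷ ks))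
        normed-body⇒¬IsQ r (now d) q =
          IsP⇒¬IsQ isP (IsQ-⟶ q (restart (plug-↓ (p ⋆ ∷ ks) d)))
        normed-body⇒¬IsQ r (later t n) q with plug-⟶⁻¹ (p ⋆ ∷ ks) t
        ... | inj₁ (r′ , _ , refl) = normed-body⇒¬IsQ r′ n (IsQ-⟶ q t)
        ... | inj₂ (d , _) = IsP⇒¬IsQ isP (IsQ-⟶ q (restart d))

        body-↓ : ∀ {r} → IsP (plug r (p ⋆ ∷ ks)) → BPA↓ A r
        body-↓ (m , r~P) with back r~P (parʳ⟶ act⟶)
        ... | s , t , s~Q with plug-⟶⁻¹ (p ⋆ ∷ ks) t
        ... | inj₁ (r′ , _ , refl) = ⊥-elim (normed-body⇒¬IsQ r′ (Q-normed m s~Q) (m , s~Q))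
        ... | inj₂ (d , _) = d

        star-⊥ : ⊥
        -- Here `r` is `p′` itself, so `restart` is a step from a state to itself.
        star-⊥ = P-irreflexive isP (restart (body-↓ isP))

      StackToP : List (BPA A) → Set
      StackToP ks = ∃[ b ] ∃[ s ] Stack⟶ ks b s × IsP s

      mutual

        -- Structural induction on `e`, for all stacks at once because the case `e · f` pushes `f`.
        ⟶P⇒StackToP : ∀ e {b e′} ks → BPA⟶ A e b e′ → IsP (plug e′ ks) → StackToP ks
        ⟶P⇒StackToP (act _) [] act⟶ (m , r) with back r (parʳ⟶ act⟶)
        ... | _ , () , _
        -- The `𝟙` left on top cannot move, so the step that matches the cycle comes from the stack.
        ⟶P⇒StackToP (act _) (k ∷ ks) act⟶ (m , r) with back r (parˡ⟶ (cycle-⟶ m))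
        ... | s , t , r′ with plug-⟶⁻¹ (k ∷ ks) t
        ... | inj₂ (_ , t′) = _ , s , t′ , m ⁻¹ , r′
        ⟶P⇒StackToP (e · f) ks (seqˡ⟶ t) isP with ⟶P⇒StackToP e (f ∷ ks) t isP
        ... | _ , _ , t′ , isP′ = plug⟶P⇒StackToP f ks t′ isP′
        ⟶P⇒StackToP (e · f) ks (seqʳ⟶ _ t) isP = ⟶P⇒StackToP f ks t isP
        ⟶P⇒StackToP (e ⊕ f) ks (sumˡ⟶ t) isP = ⟶P⇒StackToP e ks t isP
        ⟶P⇒StackToP (e ⊕ f) ks (sumʳ⟶ t) isP = ⟶P⇒StackToP f ks t isP
        ⟶P⇒StackToP (e ⋆) ks (star⟶ t) isP = ⊥-elim (star-⊥ ks t isP)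

        plug⟶P⇒StackToP : ∀ e {b s} ks → BPA⟶ A (plug e ks) b s → IsP s → StackToP ks
        plug⟶P⇒StackToP e ks t isP with plug-⟶⁻¹ ks t
        ... | inj₁ (_ , t′ , refl) = ⟶P⇒StackToP e ks t′ isP
        ... | inj₂ (_ , t′) = _ , _ , t′ , isP

      ¬IsP : ∀ e → ¬ IsP e
      ¬IsP e (m , r) with back r (parˡ⟶ (cycle-⟶ m))
      ... | s , t , r′ with plug⟶P⇒StackToP e [] t (m ⁻¹ , r′)
      ... | _ , _ , () , _

theorem21 : (A : Set) → A → LessExpressive (BPA*01 A) (PA*01 A)
theorem21 A a =
    (λ p → embed p , embed-bisimilar p)
  , P a 0ℙ , λ (e , _ , bisim , r) → ¬IsP a bisim e (0ℙ , r)
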